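{- Let $x$ be a reduced quadratic surd, let $[a_0,a_1,a_2,\dots]$ be its continued fraction expansion and $(\zeta_n)_{n\ge0}$ its sequence of complete quotients. Put $\alpha=-\frac{1}{x^*}$ (which is also a reduced quadratic surd) and write $\alpha=\frac{\sqrt N+p}{q}$, where $N$ is a positive integer which is not a perfect square, $p$ is a positive integer with $p^2<N$, $q$ is a positive integer dividing $N-p^2$, and $(p-q)^2<N<(p+q)^2$. Let $(y_n)_{n\ge0}$ and $(t_n)_{n\ge0}$ be the sequences of direction-change values and of step counts of the left-positive path (LPP) of $\alpha$ (not of $x$). Then, for every non-negative integer $n$: - $\zeta_n=-\frac{1}{y_n^*}$ if $n$ is even and $\zeta_n=-y_n^*$ if $n$ is odd; - $a_n=t_n$.
   Context: An irrational number $x$ is a reduced quadratic surd if $x$ is a root of a quadratic polynomial with integer coefficients, $x>1$, and its conjugate $x^*$ (the other root) satisfies $-1<x^*<0$. Every reduced quadratic surd can be written in the form $\frac{\sqrt N+p}{q}$ with $N,p,q$ as described in the claim. For rational numbers $a,b$, the algebraic conjugate of $a\sqrt N+b$ is $(a\sqrt N+b)^*=-a\sqrt N+b$. The (regular) continued fraction expansion of $x$ is defined by $\zeta_0=x$, $a_0=\lfloor\zeta_0\rfloor$ and, for every integer $n\ge0$, $\zeta_{n+1}=\frac{1}{\zeta_n-a_n}$, $a_{n+1}=\lfloor\zeta_{n+1}\rfloor$; the $\zeta_n$ are the complete quotients. The Calkin-Wilf tree of $\alpha$ is the infinite binary tree whose root is labeled $\alpha$ and in which every vertex labeled $z$ has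 a left child labeled $\frac{z}{z+1}$ and a right child labeled $z+1$ (since $\alpha>0$, all labels are positive). Each vertex carries a triple $(\varepsilon,c,d)$ with $\varepsilon\in\{ -1,1\}$, $c$ an integer, $d$ a positive integer dividing $N-c^2$, and label equal to $\frac{\varepsilon\sqrt N+c}{d}$, defined as follows. The root has triple $(1,p,q)$. If a vertex has triple $(\varepsilon,c,d)$, its right child has triple $(\varepsilon,c+d,d)$; its left child has triple $\left(-\varepsilon,\frac{N-c^2}{d}-c,\frac{N-(c+d)^2}{d}\right)$ if $N-(c+d)^2>0$, and $\left(\varepsilon,c-\frac{N-c^2}{d},\frac{(c+d)^2-N}{d}\right)$ otherwise. The left-positive path (LPP) of $\alpha$ is the infinite descending path which starts at the root and which, from each vertex, goes to the left child if the value of $\varepsilon$ for that left child is $1$, and to the right child otherwise. $x_n$ denotes the label of the $n$-th vertex of the LPP, with $x_0=\alpha$. Put $s_n=\ell$ if the step from $x_n$ to $x_{n+1}$ goes to the left child, and $s_n=r$ if it goes to the right child. Direction changes: put $\varphi(0)=0$ and, for $n\ge0$, let $\varphi(n+1)$ be the least integer $k>\varphi(n)$ with $s_{k-1}\ne s_k$ (such $k$ always exists). Put $y_n=x_{\varphi(n)}$ and $t_n=\varphi(n+1)-\varphi(n)$. -}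

module Defs where

open import Data.Bool.Base using (if_then_else_)
open import Data.Integer.Base as ℤ using (ℤ; +_; +0; +[1+_]; -[1+_])
open import Data.Integer.Properties as ℤ using ()
open import Data.Nat.Base as ℕ using (ℕ; zero; suc)
open import Data.Product.Base using (_×_)
open import Data.Rational.Base as ℚ using (ℚ; 0ℚ; 1ℚ)
open import Data.Rational.Properties as ℚ using ()
open import Data.Sign.Base as Sign using (Sign)
open import Data.Sum.Base using (_⊎_)
open import Relation.Binary.PropositionalEquality using (_≡_; _≢_)
open import Relation.Nullary.Decidable using (yes; no; does)

infix  4 _<_ _≤_
infixl 6 _+_ _-_
infixl 7 _*_ _÷_
infix  8 -_ _⁻¹

-- a √+ b is the real number a√N + b.  Propositional equality is equality
-- of real numbers provided that N is not a perfect square.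
record ℚ√ (N : ℕ) : Set where
  constructor _√+_
  field
    surd     : ℚ
    rational : ℚ

infix 5 _√+_

fromℚ : ∀ {N} → ℚ → ℚ√ N
fromℚ r = 0ℚ √+ r

fromℤ : ∀ {N} → ℤ → ℚ√ N
fromℤ i = fromℚ (i ℚ./ 1)

0√ 1√ : ∀ {N} → ℚ√ N
0√ = fromℚ 0ℚ
1√ = fromℚ 1ℚ

_+_ : ∀ {N} → ℚ√ N → ℚ√ N → ℚ√ N
(a √+ b) + (a′ √+ b′) = (a ℚ.+ a′) √+ (b ℚ.+ b′)

-_ : ∀ {N} → ℚ√ N → ℚ√ N
- (a √+ b) = (ℚ.- a) √+ (ℚ.- b)

_-_ : ∀ {N} → ℚ√ N → ℚ√ N → ℚ√ N
z - w = z + - w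

_*_ : ∀ {N} → ℚ√ N → ℚ√ N → ℚ√ N
_*_ {N} (a √+ b) (a′ √+ b′) =
  (a ℚ.* b′ ℚ.+ b ℚ.* a′) √+ (b ℚ.* b′ ℚ.+ (+ N ℚ./ 1) ℚ.* (a ℚ.* a′))

conj : ∀ {N} → ℚ√ N → ℚ√ N
conj (a √+ b) = (ℚ.- a) √+ b

norm : ∀ {N} → ℚ√ N → ℚ
norm {N} (a √+ b) = b ℚ.* b ℚ.- (+ N ℚ./ 1) ℚ.* (a ℚ.* a)

-- Total inverses, with the convention that the inverse of 0 is 0.
invℚ : ℚ → ℚ
invℚ r with r ℚ.≟ 0ℚ
... | yes _  = 0ℚ
... | no r≢0 = ℚ.1/_ r {{ℚ.≢-nonZero r≢0}}

_⁻¹ : ∀ {N} → ℚ√ N → ℚ√ N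
z ⁻¹ = conj z * fromℚ (invℚ (norm z))

_÷_ : ∀ {N} → ℚ√ N → ℚ√ N → ℚ√ N
z ÷ w = z * w ⁻¹

-- The map t ↦ t∣t∣ is odd and strictly increasing on the reals, so
-- a√N > -b if and only if N a∣a∣ > - b∣b∣.
Positive : ∀ {N} → ℚ√ N → Set
Positive {N} (a √+ b) =
  0ℚ ℚ.< (+ N ℚ./ 1) ℚ.* (a ℚ.* ℚ.∣ a ∣) ℚ.+ b ℚ.* ℚ.∣ b ∣

_<_ : ∀ {N} → ℚ√ N → ℚ√ N → Set
z < w = Positive (w - z)

_≤_ : ∀ {N} → ℚ√ N → ℚ√ N → Set
z ≤ w = z < w ⊎ z ≡ w

Irrational : ∀ {N} → ℚ√ N → Set
Irrational x = ∀ r → x ≢ fromℚ r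

IsRoot : ∀ {N} → ℤ → ℤ → ℤ → ℚ√ N → Set
IsRoot A B C x = fromℤ A * (x * x) + fromℤ B * x + fromℤ C ≡ 0√

-- As x is irrational, conj x ≢ x, so conj x is the other root.
record IsReducedQuadraticSurd {N : ℕ} (x : ℚ√ N) : Set where
  field
    irrational : Irrational x
    A B C      : ℤ
    A≢0        : A ≢ +0
    root       : IsRoot A B C x
    otherRoot  : IsRoot A B C (conj x)
    x>1        : 1√ < x
    conj>-1    : - 1√ < conj x
    conj<0     : conj x < 0√

IsFloor : ∀ {N} → ℚ√ N → ℤ → Set
IsFloor z n = fromℤ n ≤ z × z < fromℤ (ℤ.suc n)

-- a is the continued fraction expansion of x, and ζ its sequence of complete
-- quotients.
record IsContinuedFraction {N : ℕ} (x : ℚ√ N)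
                           (a : ℕ → ℤ) (ζ : ℕ → ℚ√ N) : Set where
  field
    ζ-zero  : ζ 0 ≡ x
    a-floor : ∀ n → IsFloor (ζ n) (a n)
    ζ-suc   : ∀ n → ζ (suc n) ≡ 1√ ÷ (ζ n - fromℤ (a n))

-- Integer division, with the convention that i div 0 is 0.  It is only
-- applied below to positive divisors that divide exactly.
_div_ : ℤ → ℤ → ℤ
i div +0           = +0
i div j@(+[1+ _ ]) = i ℤ./ j
i div j@(-[1+ _ ]) = i ℤ./ j

record Triple : Set where
  constructor triple
  field
    ε   : Sign
    c d : ℤ

rightTriple : Triple → Triple
rightTriple (triple ε c d) = triple ε (c ℤ.+ d) d

leftTriple : ℕ → Triple → Triple
leftTriple N (triple ε c d) =
  if does (+0 ℤ.<? M)
  then triple (Sign.opposite ε) (e ℤ.- c) (M div d)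
  else triple ε (c ℤ.- e) ((ℤ.- M) div d)
  where
  e = (+ N ℤ.- c ℤ.* c) div d
  M = + N ℤ.- (c ℤ.+ d) ℤ.* (c ℤ.+ d)

-- The label follows the rules z ↦ z/(z + 1) and z ↦ z + 1 of the tree; that it
-- equals (ε√N + c)/d is a consequence and is not built in.
record Vertex (N : ℕ) : Set where
  constructor vertex
  field
    label : ℚ√ N
    εcd   : Triple

open Vertex public using (label)

leftChild rightChild : ∀ {N} → Vertex N → Vertex N
leftChild  {N} (vertex z T) = vertex (z ÷ (z + 1√)) (leftTriple N T)
rightChild     (vertex z T) = vertex (z + 1√) (rightTriple T)

root : ∀ {N} → ℚ√ N → ℕ → ℕ → Vertex N
root α p q = vertex α (triple Sign.+ (+ p) (+ q))

data Direction : Set where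
  ℓ r : Direction

direction : ∀ {N} → Vertex N → Direction
direction v with Triple.ε (Vertex.εcd (leftChild v))
... | Sign.+ = ℓ
... | Sign.- = r

child : ∀ {N} → Direction → Vertex N → Vertex N
child ℓ = leftChild
child r = rightChild

-- lpp v n is the n-th vertex of the left-positive path starting at v.
lpp : ∀ {N} → Vertex N → ℕ → Vertex N
lpp v zero    = v
lpp v (suc n) = child (direction (lpp v n)) (lpp v n)

-- Any k > φ n is positive, so k ∸ 1 is never truncated.
record IsDirectionChangeSequence (s : ℕ → Direction) (φ : ℕ → ℕ) : Set where
  field
    φ-zero  : φ 0 ≡ 0
    φ-mono  : ∀ n → φ n ℕ.< φ (suc n)
    changes : ∀ n → s (φ (suc n) ℕ.∸ 1) ≢ s (φ (suc n))
    least   : ∀ n k → φ n ℕ.< k → s (k ℕ.∸ 1) ≢ s k → φ (suc n) ℕ.≤ k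

{-# OPTIONS --safe #-}
-- Along the left-positive path ε is always 1, and a vertex (c, d) with label
-- (√N + c)/d is completed by e = (N - c²)/d > 0 to a form with de + c² = N.
-- With u = -z* = (√N - c)/d for the label z, a left step replaces 1/u by
-- 1/u - 1 and a right step replaces u by u - 1, and the path goes left exactly
-- when u < 1.  The path is thus the subtractive Euclidean algorithm on u, and
-- its runs compute the continued fraction of 1/u₀ = -1/α* = x.  Left and right
-- are exchanged by (c, d, e) ↦ (-c, e, d), so only one kind of run is analysed.
module Submission where

open import Defs
open import Data.Integer.Base as ℤ using (ℤ; +_; +0; +[1+_]; -[1+_]; 0ℤ; 1ℤ; -1ℤ)
open import Data.Integer.Properties as ℤ using ()
open import Data.Integer.Tactic.RingSolver using (solve-∀)
open import Data.Nat.Base as ℕ using (ℕ; zero; suc; NonZero; _∸_; ∣_-_∣; _^_)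
open import Data.Nat.Coprimality as Coprime using (1-coprimeTo)
open import Data.Nat.Divisibility as ℕ using (_∣_; divides)
open import Data.Nat.DivMod as ℕ using ()
open import Data.Nat.Properties as ℕ using ()
open import Data.Product.Base using (_×_; _,_; ∃-syntax; proj₁; proj₂)
open import Data.Rational.Base as ℚ using (ℚ; mkℚ; 0ℚ; 1ℚ)
open import Data.Rational.Properties as ℚ using ()
open import Data.Rational.Solver using (module +-*-Solver)
open import Data.Rational.Unnormalised.Base as ℚᵘ using (mkℚᵘ; *≡*)
open import Data.Rational.Unnormalised.Properties as ℚᵘ using ()
open import Data.Sign.Base as Sign using (Sign)
open import Data.Sum.Base using (inj₁; inj₂)
open import Function.Base using (_∘_)
open import Relation.Binary.Definitions using (tri<; tri≈; tri>; DecidableEquality)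
open import Relation.Binary.PropositionalEquality
open import Relation.Nullary.Decidable using (yes; no; dec-true; dec-false; decidable-stable)
open import Relation.Nullary.Negation using (¬_; contradiction)

-- Integers and their quotients inside ℚ.

ι : ℤ → ℚ
ι i = i ℚ./ 1

-- `i ℚ./ 1` normalises through a gcd, which is stuck on a variable. The explicit fraction on the
-- right lets sums, products and comparisons compute.
ι-mkℚ : ∀ i → ι i ≡ mkℚ i 0 (Coprime.sym (1-coprimeTo ℤ.∣ i ∣))
ι-mkℚ i = ℚ.↥p/↧p≡p (mkℚ i 0 (Coprime.sym (1-coprimeTo ℤ.∣ i ∣)))

ι-+ : ∀ i j → ι (i ℤ.+ j) ≡ ι i ℚ.+ ι j
ι-+ i j = sym (trans (cong₂ ℚ._+_ (ι-mkℚ i) (ι-mkℚ j))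
  (cong ι (cong₂ ℤ._+_ (ℤ.*-identityʳ i) (ℤ.*-identityʳ j))))

ι-* : ∀ i j → ι (i ℤ.* j) ≡ ι i ℚ.* ι j
ι-* i j = sym (cong₂ ℚ._*_ (ι-mkℚ i) (ι-mkℚ j))

ι-neg : ∀ i → ι (ℤ.- i) ≡ ℚ.- ι i
ι-neg +0       = refl
ι-neg +[1+ _ ] = refl
-- `ι -[1+ n ]` unfolds to the negative of `ι +[1+ n ]`, so a double negation is left.
ι-neg -[1+ n ] = +-*-Solver.solve 1 (λ x → x := :- (:- x)) refl (ι +[1+ n ])
  where open +-*-Solver using (_:=_; :-_)

ι-∣∣ : ∀ i → ι (+ ℤ.∣ i ∣) ≡ ℚ.∣ ι i ∣
ι-∣∣ i = trans (ι-mkℚ (+ ℤ.∣ i ∣)) (sym (trans (cong ℚ.∣_∣ (ι-mkℚ i)) (∣mkℚ∣ i)))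
  where
  ∣mkℚ∣ : ∀ i → ℚ.∣ mkℚ i 0 (Coprime.sym (1-coprimeTo ℤ.∣ i ∣)) ∣ ≡
          mkℚ (+ ℤ.∣ i ∣) 0 (Coprime.sym (1-coprimeTo ℤ.∣ i ∣))
  ∣mkℚ∣ +0       = refl
  ∣mkℚ∣ +[1+ _ ] = refl
  ∣mkℚ∣ -[1+ _ ] = refl

ι-positive⁻¹ : ∀ {i} → 0ℚ ℚ.< ι i → 0ℤ ℤ.< i
ι-positive⁻¹ {i} 0<ιi =
  subst (0ℤ ℤ.<_) (ℤ.*-identityʳ i) (ℚ.drop-*<* (subst (0ℚ ℚ.<_) (ι-mkℚ i) 0<ιi))

ι-positive : ∀ {i} → 0ℤ ℤ.< i → 0ℚ ℚ.< ι i
ι-positive {i} 0<i = subst (0ℚ ℚ.<_) (sym (ι-mkℚ i))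
  (ℚ.*<* (subst (0ℤ ℤ.<_) (sym (ℤ.*-identityʳ i)) 0<i))

*-invℚ : ∀ {x} → x ≢ 0ℚ → x ℚ.* invℚ x ≡ 1ℚ
*-invℚ {x} x≢0 with x ℚ.≟ 0ℚ
... | yes x≡0 = contradiction x≡0 x≢0
... | no  x≢0 = ℚ.*-inverseʳ x {{ℚ.≢-nonZero x≢0}}

-- recip 0 = 0, hence frac i 0 = 0.
recip : ℤ → ℚ
recip d = invℚ (ι d)

frac : ℤ → ℤ → ℚ
frac i d = ι i ℚ.* recip d

*-recip : ∀ {d} → 0ℤ ℤ.< d → frac d d ≡ 1ℚ
*-recip 0<d = *-invℚ (ℚ.<⇒≢ (ι-positive 0<d) ∘ sym)

recip-positive : ∀ {d} → 0ℤ ℤ.< d → 0ℚ ℚ.< recip d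
recip-positive {d} 0<d =
  ℚ.*-cancelˡ-<-nonNeg (ι d) {{ℚ.nonNegative (ℚ.<⇒≤ (ι-positive 0<d))}}
    (subst₂ ℚ._<_ (sym (ℚ.*-zeroʳ (ι d))) (sym (*-recip 0<d)) (ℚ.positive⁻¹ 1ℚ))

frac-+ : ∀ i j d → frac i d ℚ.+ frac j d ≡ frac (i ℤ.+ j) d
frac-+ i j d = sym (trans (cong (ℚ._* recip d) (ι-+ i j)) (ℚ.*-distribʳ-+ (recip d) (ι i) (ι j)))

frac-neg : ∀ i d → ℚ.- frac i d ≡ frac (ℤ.- i) d
frac-neg i d = trans (ℚ.neg-distribˡ-* (ι i) (recip d)) (cong (ℚ._* recip d) (sym (ι-neg i)))

frac-integer : ∀ i {d} → 0ℤ ℤ.< d → ι i ≡ frac (i ℤ.* d) d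
frac-integer i {d} 0<d = begin
  ι i                        ≡⟨ ℚ.*-identityʳ (ι i) ⟨
  ι i ℚ.* 1ℚ                 ≡⟨ cong (ι i ℚ.*_) (*-recip 0<d) ⟨
  ι i ℚ.* (ι d ℚ.* recip d)  ≡⟨ ℚ.*-assoc (ι i) (ι d) (recip d) ⟨
  ι i ℚ.* ι d ℚ.* recip d    ≡⟨ cong (ℚ._* recip d) (ι-* i d) ⟨
  frac (i ℤ.* d) d           ∎
  where open ≡-Reasoning

frac-unique : ∀ i d x → 0ℤ ℤ.< d → x ℚ.* ι d ≡ ι i → x ≡ frac i d
frac-unique i d x 0<d xd≡i = begin
  x                          ≡⟨ ℚ.*-identityʳ x ⟨
  x ℚ.* 1ℚ                   ≡⟨ cong (x ℚ.*_) (*-recip 0<d) ⟨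
  x ℚ.* (ι d ℚ.* recip d)    ≡⟨ ℚ.*-assoc x (ι d) (recip d) ⟨
  x ℚ.* ι d ℚ.* recip d      ≡⟨ cong (ℚ._* recip d) xd≡i ⟩
  frac i d                   ∎
  where open ≡-Reasoning

-- The two sides are built differently, by normalisation and by a total inverse. After
-- multiplication by q the claim is a cross multiplication of unnormalised rationals. It brings the
-- given form of α into the shape `mk`.
/-frac : ∀ i q .{{_ : NonZero q}} → i ℚ./ q ≡ frac i (+ q)
/-frac i (suc q) = frac-unique i (+ suc q) (i ℚ./ suc q) (ℤ.+<+ ℕ.z<s) (ℚ.toℚᵘ-injective eq)
  where
  open ℚᵘ.≃-Reasoning
  eq : ℚ.toℚᵘ ((i ℚ./ suc q) ℚ.* ι (+ suc q)) ℚᵘ.≃ ℚ.toℚᵘ (ι i)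
  eq = begin
    ℚ.toℚᵘ ((i ℚ./ suc q) ℚ.* ι (+ suc q))          ≈⟨ ℚ.toℚᵘ-homo-* (i ℚ./ suc q) (ι (+ suc q)) ⟩
    ℚ.toℚᵘ (i ℚ./ suc q) ℚᵘ.* ℚ.toℚᵘ (ι (+ suc q))
      ≈⟨ ℚᵘ.*-cong (ℚ.toℚᵘ-fromℚᵘ (mkℚᵘ i q)) (ℚ.toℚᵘ-fromℚᵘ (mkℚᵘ (+ suc q) 0)) ⟩
    mkℚᵘ i q ℚᵘ.* mkℚᵘ (+ suc q) 0
      ≈⟨ *≡* (trans (ℤ.*-identityʳ _) (cong (λ n → i ℤ.* (+ suc n)) (sym (ℕ.*-identityʳ q)))) ⟩
    mkℚᵘ i 0                                        ≈⟨ ℚ.toℚᵘ-fromℚᵘ (mkℚᵘ i 0) ⟨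
    ℚ.toℚᵘ (ι i)                                    ∎

-- Arithmetic of (s√N + m)/d and uniqueness of inverses.

module _ {N : ℕ} where

  -- (s√N + m)/d
  mk : ℤ → ℤ → ℤ → ℚ√ N
  mk s m d = frac s d √+ frac m d

  mk-+ : ∀ s m s′ m′ d → mk s m d + mk s′ m′ d ≡ mk (s ℤ.+ s′) (m ℤ.+ m′) d
  mk-+ s m s′ m′ d = cong₂ _√+_ (frac-+ s s′ d) (frac-+ m m′ d)

  mk-neg : ∀ s m d → - mk s m d ≡ mk (ℤ.- s) (ℤ.- m) d
  mk-neg s m d = cong₂ _√+_ (frac-neg s d) (frac-neg m d)

  mk-conj : ∀ s m d → conj (mk s m d) ≡ mk (ℤ.- s) m d
  mk-conj s m d = cong (_√+ frac m d) (frac-neg s d)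

  mk-integer : ∀ i {d} → 0ℤ ℤ.< d → fromℤ i ≡ mk 0ℤ (i ℤ.* d) d
  mk-integer i {d} 0<d = cong₂ _√+_ (frac-integer 0ℤ 0<d) (frac-integer i 0<d)

  -- The plain product has denominator dd′. The two equations say that d divides both numerators, so
  -- d cancels and d′ remains.
  mk-*-mk : ∀ s m d s′ m′ d′ s″ m″ → 0ℤ ℤ.< d →
            s ℤ.* m′ ℤ.+ m ℤ.* s′ ≡ s″ ℤ.* d →
            m ℤ.* m′ ℤ.+ + N ℤ.* (s ℤ.* s′) ≡ m″ ℤ.* d →
            mk s m d * mk s′ m′ d′ ≡ mk s″ m″ d′
  mk-*-mk s m d s′ m′ d′ s″ m″ 0<d s-eq m-eq = cong₂ _√+_
    (begin
      frac s d ℚ.* frac m′ d′ ℚ.+ frac m d ℚ.* frac s′ d′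
        ≡⟨ +-*-Solver.solve 6 (λ s m i s′ m′ i′ →
             (s :* i) :* (m′ :* i′) :+ (m :* i) :* (s′ :* i′) :=
             (s :* m′ :+ m :* s′) :* i :* i′) refl
             (ι s) (ι m) (recip d) (ι s′) (ι m′) (recip d′) ⟩
      (ι s ℚ.* ι m′ ℚ.+ ι m ℚ.* ι s′) ℚ.* recip d ℚ.* recip d′
        ≡⟨ cong (λ x → x ℚ.* recip d ℚ.* recip d′)
             (trans (cong₂ ℚ._+_ (sym (ι-* s m′)) (sym (ι-* m s′))) (sym (ι-+ (s ℤ.* m′) (m ℤ.* s′)))) ⟩
      frac (s ℤ.* m′ ℤ.+ m ℤ.* s′) d ℚ.* recip d′
        ≡⟨ cong (λ i → frac i d ℚ.* recip d′) s-eq ⟩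
      frac (s″ ℤ.* d) d ℚ.* recip d′
        ≡⟨ cong (ℚ._* recip d′) (frac-integer s″ 0<d) ⟨
      frac s″ d′ ∎)
    (begin
      frac m d ℚ.* frac m′ d′ ℚ.+ ι (+ N) ℚ.* (frac s d ℚ.* frac s′ d′)
        ≡⟨ +-*-Solver.solve 7 (λ n s m i s′ m′ i′ →
             (m :* i) :* (m′ :* i′) :+ n :* ((s :* i) :* (s′ :* i′)) :=
             (m :* m′ :+ n :* (s :* s′)) :* i :* i′) refl
             (ι (+ N)) (ι s) (ι m) (recip d) (ι s′) (ι m′) (recip d′) ⟩
      (ι m ℚ.* ι m′ ℚ.+ ι (+ N) ℚ.* (ι s ℚ.* ι s′)) ℚ.* recip d ℚ.* recip d′
        ≡⟨ cong (λ x → x ℚ.* recip d ℚ.* recip d′)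
             (trans (cong₂ ℚ._+_ (sym (ι-* m m′))
               (trans (cong (ι (+ N) ℚ.*_) (sym (ι-* s s′))) (sym (ι-* (+ N) (s ℤ.* s′)))))
               (sym (ι-+ (m ℤ.* m′) (+ N ℤ.* (s ℤ.* s′))))) ⟩
      frac (m ℤ.* m′ ℤ.+ + N ℤ.* (s ℤ.* s′)) d ℚ.* recip d′
        ≡⟨ cong (λ i → frac i d ℚ.* recip d′) m-eq ⟩
      frac (m″ ℤ.* d) d ℚ.* recip d′
        ≡⟨ cong (ℚ._* recip d′) (frac-integer m″ 0<d) ⟨
      frac m″ d′ ∎)
    where
    open ≡-Reasoning
    open +-*-Solver using (_:+_; _:*_; _:=_)

  mk-inverse : ∀ s m d s′ m′ d′ → 0ℤ ℤ.< d → 0ℤ ℤ.< d′ →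
               s ℤ.* m′ ℤ.+ m ℤ.* s′ ≡ 0ℤ →
               m ℤ.* m′ ℤ.+ + N ℤ.* (s ℤ.* s′) ≡ d′ ℤ.* d →
               mk s m d * mk s′ m′ d′ ≡ 1√
  mk-inverse s m d s′ m′ d′ 0<d 0<d′ s-eq m-eq =
    trans (mk-*-mk s m d s′ m′ d′ 0ℤ d′ 0<d s-eq m-eq)
          (cong₂ _√+_ (ℚ.*-zeroˡ (recip d′)) (*-recip 0<d′))

  -- The norm is multiplicative, so norm w is invertible.
  ⁻¹-unique : ∀ (w w′ : ℚ√ N) → w * w′ ≡ 1√ → w ⁻¹ ≡ w′
  ⁻¹-unique (a √+ b) (a′ √+ b′) ww′≡1 = cong₂ _√+_
    (begin
      (ℚ.- a) ℚ.* ν ℚ.+ b ℚ.* 0ℚ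
        -- The factors 0 and 1 are put in on purpose: they are the coordinates `S` and `R` of the
        -- product of `w` and `w′`, and writing these back makes `norm w` a factor.
        ≡⟨ solve 3 (λ a b ν → (:- a) :* ν :+ b :* con 0ℚ :=
             (con 0ℚ :* b :- a :* con 1ℚ) :* ν) refl a b ν ⟩
      (0ℚ ℚ.* b ℚ.- a ℚ.* 1ℚ) ℚ.* ν
        ≡⟨ cong₂ (λ x y → (x ℚ.* b ℚ.- a ℚ.* y) ℚ.* ν) (sym S≡0) (sym R≡1) ⟩
      (S ℚ.* b ℚ.- a ℚ.* R) ℚ.* ν
        ≡⟨ solve 6 (λ n a b a′ b′ ν →
             ((a :* b′ :+ b :* a′) :* b :- a :* (b :* b′ :+ n :* (a :* a′))) :* ν :=
             a′ :* ((b :* b :- n :* (a :* a)) :* ν)) refl n a b a′ b′ ν ⟩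
      a′ ℚ.* (norm w ℚ.* ν)               ≡⟨ cong (a′ ℚ.*_) normw*ν≡1 ⟩
      a′ ℚ.* 1ℚ                           ≡⟨ ℚ.*-identityʳ a′ ⟩
      a′                                  ∎)
    (begin
      b ℚ.* ν ℚ.+ n ℚ.* ((ℚ.- a) ℚ.* 0ℚ)
        ≡⟨ solve 4 (λ n a b ν → b :* ν :+ n :* ((:- a) :* con 0ℚ) :=
             (b :* con 1ℚ :- n :* (a :* con 0ℚ)) :* ν) refl n a b ν ⟩
      (b ℚ.* 1ℚ ℚ.- n ℚ.* (a ℚ.* 0ℚ)) ℚ.* ν
        ≡⟨ cong₂ (λ x y → (b ℚ.* y ℚ.- n ℚ.* (a ℚ.* x)) ℚ.* ν) (sym S≡0) (sym R≡1) ⟩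
      (b ℚ.* R ℚ.- n ℚ.* (a ℚ.* S)) ℚ.* ν
        ≡⟨ solve 6 (λ n a b a′ b′ ν →
             (b :* (b :* b′ :+ n :* (a :* a′)) :- n :* (a :* (a :* b′ :+ b :* a′))) :* ν :=
             b′ :* ((b :* b :- n :* (a :* a)) :* ν)) refl n a b a′ b′ ν ⟩
      b′ ℚ.* (norm w ℚ.* ν)               ≡⟨ cong (b′ ℚ.*_) normw*ν≡1 ⟩
      b′ ℚ.* 1ℚ                           ≡⟨ ℚ.*-identityʳ b′ ⟩
      b′                                  ∎)
    where
    open ≡-Reasoning
    open +-*-Solver
    n S R ν : ℚ
    w w′ : ℚ√ N
    w  = a √+ b
    w′ = a′ √+ b′
    n = ι (+ N)
    S = a ℚ.* b′ ℚ.+ b ℚ.* a′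
    R = b ℚ.* b′ ℚ.+ n ℚ.* (a ℚ.* a′)
    ν = invℚ (norm w)
    S≡0 : S ≡ 0ℚ
    S≡0 = cong ℚ√.surd ww′≡1
    R≡1 : R ≡ 1ℚ
    R≡1 = cong ℚ√.rational ww′≡1
    norm-* : norm w ℚ.* norm w′ ≡ R ℚ.* R ℚ.- n ℚ.* (S ℚ.* S)
    norm-* = solve 5 (λ n a b a′ b′ →
      (b :* b :- n :* (a :* a)) :* (b′ :* b′ :- n :* (a′ :* a′)) :=
      (b :* b′ :+ n :* (a :* a′)) :* (b :* b′ :+ n :* (a :* a′)) :-
      n :* ((a :* b′ :+ b :* a′) :* (a :* b′ :+ b :* a′))) refl n a b a′ b′
    normw≢0 : norm w ≢ 0ℚ
    normw≢0 normw≡0 = contradiction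
      (begin
        0ℚ                                        ≡⟨ ℚ.*-zeroˡ (norm w′) ⟨
        0ℚ ℚ.* norm w′                            ≡⟨ cong (ℚ._* norm w′) normw≡0 ⟨
        norm w ℚ.* norm w′                        ≡⟨ norm-* ⟩
        R ℚ.* R ℚ.- n ℚ.* (S ℚ.* S)               ≡⟨ cong₂ (λ x y → y ℚ.* y ℚ.- n ℚ.* (x ℚ.* x)) S≡0 R≡1 ⟩
        1ℚ ℚ.* 1ℚ ℚ.- n ℚ.* (0ℚ ℚ.* 0ℚ)
          ≡⟨ solve 1 (λ n → con 1ℚ :* con 1ℚ :- n :* (con 0ℚ :* con 0ℚ) := con 1ℚ) refl n ⟩
        1ℚ                                        ∎)
      λ ()
    normw*ν≡1 : norm w ℚ.* ν ≡ 1ℚ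
    normw*ν≡1 = *-invℚ normw≢0

  ÷-inverse : ∀ (z w w′ : ℚ√ N) → w * w′ ≡ 1√ → z ÷ w ≡ z * w′
  ÷-inverse z w w′ ww′≡1 = cong (z *_) (⁻¹-unique w w′ ww′≡1)

  *-identityˡ : ∀ (z : ℚ√ N) → 1√ * z ≡ z
  *-identityˡ (a √+ b) = cong₂ _√+_
    (solve 2 (λ a b → con 0ℚ :* b :+ con 1ℚ :* a := a) refl a b)
    (solve 3 (λ n a b → con 1ℚ :* b :+ n :* (con 0ℚ :* a) := b) refl (ι (+ N)) a b)
    where open +-*-Solver

  1÷-unique : ∀ (w w′ : ℚ√ N) → w * w′ ≡ 1√ → 1√ ÷ w ≡ w′
  1÷-unique w w′ ww′≡1 = trans (÷-inverse 1√ w w′ ww′≡1) (*-identityˡ w′)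

-- Signs, exact division and signed squares of integers.

*-positive : ∀ {i j} → 0ℤ ℤ.< i → 0ℤ ℤ.< j → 0ℤ ℤ.< i ℤ.* j
*-positive {+[1+ _ ]} {+[1+ _ ]} _ _ = ℤ.+<+ ℕ.z<s
*-positive {+0}       (ℤ.+<+ ())
*-positive {+[1+ _ ]} {+0} _ (ℤ.+<+ ())

*-cancelˡ-positive : ∀ {i j} → 0ℤ ℤ.< i → 0ℤ ℤ.< i ℤ.* j → 0ℤ ℤ.< j
*-cancelˡ-positive {i} {j} 0<i 0<ij =
  ℤ.*-cancelˡ-<-nonNeg i {{ℤ.nonNegative (ℤ.<⇒≤ 0<i)}}
    (subst (ℤ._< i ℤ.* j) (sym (ℤ.*-zeroʳ i)) 0<ij)

div-exact : ∀ {i d} → 0ℤ ℤ.< i → 0ℤ ℤ.< d → (i ℤ.* d) div d ≡ i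
div-exact {+[1+ m ]} {+[1+ k ]} _ _ =
  -- `ℤ./` multiplies by the sign of the divisor, which is 1 here.
  trans (ℤ.*-identityˡ _) (cong +_ (ℕ.m*n/n≡m (suc m) (suc k)))
div-exact {+0}       (ℤ.+<+ ())
div-exact {+[1+ _ ]} {+0} _ (ℤ.+<+ ())

-- The integer version of the map t ↦ t∣t∣ behind `Positive`: the inequality 0 < N +
-- `signedSquare i` expresses i > -√N without roots.
signedSquare : ℤ → ℤ
signedSquare i = i ℤ.* + ℤ.∣ i ∣

signedSquare-mono : ∀ {i j} → i ℤ.≤ j → signedSquare i ℤ.≤ signedSquare j
signedSquare-mono {+0}       {+0}       _ = ℤ.≤-refl
signedSquare-mono {+0}       {+[1+ _ ]} _ = ℤ.+≤+ ℕ.z≤n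
signedSquare-mono {+[1+ _ ]} {+[1+ _ ]} (ℤ.+≤+ m≤n) = ℤ.+≤+ (ℕ.*-mono-≤ m≤n m≤n)
signedSquare-mono { -[1+ _ ]} {+0}       _ = ℤ.-≤+
signedSquare-mono { -[1+ _ ]} {+[1+ _ ]} _ = ℤ.-≤+
signedSquare-mono { -[1+ _ ]} { -[1+ _ ]} (ℤ.-≤- n≤m) =
  ℤ.-≤- (ℕ.s≤s⁻¹ (ℕ.*-mono-≤ (ℕ.s≤s n≤m) (ℕ.s≤s n≤m)))
signedSquare-mono {+[1+ _ ]} {+0} (ℤ.+≤+ ())

signedSquare-neg : ∀ i → signedSquare (ℤ.- i) ≡ ℤ.- signedSquare i
signedSquare-neg i = trans (cong (λ n → ℤ.- i ℤ.* + n) (ℤ.∣-i∣≡∣i∣ i)) (sym (ℤ.neg-distribˡ-* i (+ ℤ.∣ i ∣)))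

-- For positive n the hypotheses put -√n between j and i. If i ≤ j held, monotonicity of
-- `signedSquare` would contradict them.
signedSquare-cancel-< : ∀ {n i j} → 0ℤ ℤ.< n ℤ.+ signedSquare i → n ℤ.+ signedSquare j ℤ.< 0ℤ → j ℤ.< i
signedSquare-cancel-< {n} {i} {j} 0<n+i n+j<0 with j ℤ.<? i
... | yes j<i = j<i
... | no  j≮i = contradiction
  (ℤ.<-≤-trans 0<n+i (ℤ.+-monoʳ-≤ n (signedSquare-mono (ℤ.≮⇒≥ j≮i))))
  (ℤ.<-asym n+j<0)

signedSquare-< : ∀ {n i} → 0ℤ ℤ.< n → i ℤ.* i ℤ.< n → 0ℤ ℤ.< n ℤ.+ signedSquare i
signedSquare-< {n} {+ m} 0<n _ = ℤ.+-mono-<-≤ 0<n (ℤ.≤-trans (ℤ.+≤+ ℕ.z≤n) (ℤ.≤-reflexive (ℤ.pos-* m m)))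
-- For negative i, `signedSquare i` reduces to -i², so adding it to both sides of i² < n is enough.
signedSquare-< {n} { -[1+ m ]} _ i²<n = subst (ℤ._< n ℤ.+ signedSquare -[1+ m ])
  (ℤ.+-inverseʳ (-[1+ m ] ℤ.* -[1+ m ])) (ℤ.+-monoˡ-< (signedSquare -[1+ m ]) i²<n)

signedSquare-> : ∀ {n i} → i ℤ.< 0ℤ → n ℤ.< i ℤ.* i → n ℤ.+ signedSquare i ℤ.< 0ℤ
signedSquare-> {i = + _} (ℤ.+<+ ())
signedSquare-> {n} { -[1+ m ]} _ n<i² = subst (n ℤ.+ signedSquare -[1+ m ] ℤ.<_)
  (ℤ.+-inverseʳ (-[1+ m ] ℤ.* -[1+ m ])) (ℤ.+-monoˡ-< (signedSquare -[1+ m ]) n<i²)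

frac-signedSquare : ∀ i {d} → 0ℤ ℤ.< d →
  frac i d ℚ.* ℚ.∣ frac i d ∣ ≡ ι (signedSquare i) ℚ.* (recip d ℚ.* recip d)
frac-signedSquare i {d} 0<d = begin
  frac i d ℚ.* ℚ.∣ frac i d ∣
    ≡⟨ cong (frac i d ℚ.*_) (ℚ.∣p*q∣≡∣p∣*∣q∣ (ι i) (recip d)) ⟩
  frac i d ℚ.* (ℚ.∣ ι i ∣ ℚ.* ℚ.∣ recip d ∣)
    ≡⟨ cong₂ (λ x y → frac i d ℚ.* (x ℚ.* y)) (sym (ι-∣∣ i)) (ℚ.0≤p⇒∣p∣≡p (ℚ.<⇒≤ (recip-positive 0<d))) ⟩
  ι i ℚ.* recip d ℚ.* (ι (+ ℤ.∣ i ∣) ℚ.* recip d)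
    ≡⟨ solve 3 (λ x y z → x :* z :* (y :* z) := x :* y :* (z :* z)) refl (ι i) (ι (+ ℤ.∣ i ∣)) (recip d) ⟩
  ι i ℚ.* ι (+ ℤ.∣ i ∣) ℚ.* (recip d ℚ.* recip d)
    ≡⟨ cong (ℚ._* (recip d ℚ.* recip d)) (ι-* i (+ ℤ.∣ i ∣)) ⟨
  ι (signedSquare i) ℚ.* (recip d ℚ.* recip d) ∎
  where
  open ≡-Reasoning
  open +-*-Solver

-- Integer criteria for positivity and for floors.

module _ {N : ℕ} where

  -- Both terms in `Positive` carry the factor 1/d², which is cancelled.
  mk-positive⁻¹ : ∀ s m {d} → 0ℤ ℤ.< d → Positive {N} (mk s m d) →
                  0ℤ ℤ.< + N ℤ.* signedSquare s ℤ.+ signedSquare m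
  mk-positive⁻¹ s m {d} 0<d pos = ι-positive⁻¹
    (ℚ.*-cancelʳ-<-nonNeg (ρ ℚ.* ρ) {{ρ²-nonNeg}} (subst₂ ℚ._<_ (sym (ℚ.*-zeroˡ (ρ ℚ.* ρ))) eq pos))
    where
    open ≡-Reasoning
    open +-*-Solver
    ρ : ℚ
    ρ = recip d
    ρ²-nonNeg : ℚ.NonNegative (ρ ℚ.* ρ)
    ρ²-nonNeg = ℚ.nonNeg*nonNeg⇒nonNeg ρ {{ρ-nonNeg}} ρ {{ρ-nonNeg}}
      where
      ρ-nonNeg : ℚ.NonNegative ρ
      ρ-nonNeg = ℚ.nonNegative (ℚ.<⇒≤ (recip-positive 0<d))
    s² m² : ℤ
    s² = signedSquare s
    m² = signedSquare m
    eq : ι (+ N) ℚ.* (frac s d ℚ.* ℚ.∣ frac s d ∣) ℚ.+ frac m d ℚ.* ℚ.∣ frac m d ∣ ≡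
         ι (+ N ℤ.* s² ℤ.+ m²) ℚ.* (ρ ℚ.* ρ)
    eq = begin
      ι (+ N) ℚ.* (frac s d ℚ.* ℚ.∣ frac s d ∣) ℚ.+ frac m d ℚ.* ℚ.∣ frac m d ∣
        ≡⟨ cong₂ (λ x y → ι (+ N) ℚ.* x ℚ.+ y) (frac-signedSquare s 0<d) (frac-signedSquare m 0<d) ⟩
      ι (+ N) ℚ.* (ι s² ℚ.* (ρ ℚ.* ρ)) ℚ.+ ι m² ℚ.* (ρ ℚ.* ρ)
        ≡⟨ solve 4 (λ n x y z → n :* (x :* z) :+ y :* z := (n :* x :+ y) :* z) refl
             (ι (+ N)) (ι s²) (ι m²) (ρ ℚ.* ρ) ⟩
      (ι (+ N) ℚ.* ι s² ℚ.+ ι m²) ℚ.* (ρ ℚ.* ρ)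
        ≡⟨ cong (ℚ._* (ρ ℚ.* ρ)) (trans (cong (ℚ._+ ι m²) (sym (ι-* (+ N) s²))) (sym (ι-+ (+ N ℤ.* s²) m²))) ⟩
      ι (+ N ℤ.* s² ℤ.+ m²) ℚ.* (ρ ℚ.* ρ) ∎

  mk-minus-integer : ∀ c a {e} → 0ℤ ℤ.< e →
                     mk {N} 1ℤ c e - fromℤ a ≡ mk 1ℤ (c ℤ.- a ℤ.* e) e
  mk-minus-integer c a {e} 0<e = trans (cong (λ z → mk 1ℤ c e - z) (mk-integer a 0<e))
    (trans (cong (λ z → mk 1ℤ c e + z) (mk-neg 0ℤ (a ℤ.* e) e))
           (mk-+ 1ℤ c 0ℤ (ℤ.- (a ℤ.* e)) e))

  -- The floor a of (√N + c)/e is pinned down by c - ae > -√N > c - (a + 1)e.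
  floor-bounds : ∀ {c e a} → 0ℤ ℤ.< e → IsFloor {N} (mk 1ℤ c e) a →
                 (0ℤ ℤ.< + N ℤ.+ signedSquare (c ℤ.- a ℤ.* e)) ×
                 (+ N ℤ.+ signedSquare (c ℤ.- ℤ.suc a ℤ.* e) ℤ.< 0ℤ)
  floor-bounds {c} {e} {a} 0<e (a≤z , z<1+a) = lower a≤z , upper
    where
    lower : fromℤ a ≤ mk 1ℤ c e → 0ℤ ℤ.< + N ℤ.+ signedSquare (c ℤ.- a ℤ.* e)
    lower (inj₁ a<z) =
      subst (λ n → 0ℤ ℤ.< n ℤ.+ signedSquare (c ℤ.- a ℤ.* e)) (ℤ.*-identityʳ (+ N))
        (mk-positive⁻¹ 1ℤ (c ℤ.- a ℤ.* e) 0<e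
          (subst (Positive {N}) (mk-minus-integer c a 0<e) a<z))
    -- Equality is impossible: the coefficient of √N is 0 on one side and 1/e > 0 on the other.
    lower (inj₂ a≡z) = contradiction
      (trans (cong ℚ√.surd a≡z) (ℚ.*-identityˡ (recip e))) (ℚ.<⇒≢ (recip-positive 0<e))
    upper : + N ℤ.+ signedSquare (c ℤ.- ℤ.suc a ℤ.* e) ℤ.< 0ℤ
    -- The criterion is applied to (a + 1) - z, where √N has coefficient -1/e. As `signedSquare` is
    -- odd, this yields the wanted inequality with both sides negated.
    upper = ℤ.neg-cancel-< (subst (0ℤ ℤ.<_) eq
      (mk-positive⁻¹ -1ℤ (ℤ.suc a ℤ.* e ℤ.- c) 0<e
        (subst (Positive {N}) (trans (cong (λ z → z - mk 1ℤ c e) (mk-integer (ℤ.suc a) 0<e))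
                        (trans (cong (λ z → mk 0ℤ (ℤ.suc a ℤ.* e) e + z) (mk-neg 1ℤ c e))
                               (mk-+ 0ℤ (ℤ.suc a ℤ.* e) -1ℤ (ℤ.- c) e))) z<1+a)))
      where
      open ≡-Reasoning
      g : ℤ
      g = c ℤ.- ℤ.suc a ℤ.* e
      lemma : ∀ n i → n ℤ.* -1ℤ ℤ.+ ℤ.- i ≡ ℤ.- (n ℤ.+ i)
      lemma = solve-∀
      swap : ∀ i j → i ℤ.- j ≡ ℤ.- (j ℤ.- i)
      swap = solve-∀
      eq : + N ℤ.* -1ℤ ℤ.+ signedSquare (ℤ.suc a ℤ.* e ℤ.- c) ≡ ℤ.- (+ N ℤ.+ signedSquare g)
      eq = begin
        + N ℤ.* -1ℤ ℤ.+ signedSquare (ℤ.suc a ℤ.* e ℤ.- c)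
          ≡⟨ cong (λ i → + N ℤ.* -1ℤ ℤ.+ i) (trans (cong signedSquare (swap (ℤ.suc a ℤ.* e) c)) (signedSquare-neg g)) ⟩
        + N ℤ.* -1ℤ ℤ.+ ℤ.- signedSquare g
          ≡⟨ lemma (+ N) (signedSquare g) ⟩
        ℤ.- (+ N ℤ.+ signedSquare g) ∎

-- Involutions, injectivity of inversion and uniqueness of the floor.

neg-involutive : ∀ x → ℚ.- (ℚ.- x) ≡ x
neg-involutive = +-*-Solver.solve 1 (λ x → :- (:- x) := x) refl
  where open +-*-Solver using (_:=_; :-_)

module _ {N : ℕ} where

  conj-involutive : ∀ (z : ℚ√ N) → conj (conj z) ≡ z
  conj-involutive (a √+ b) = cong (_√+ b) (neg-involutive a)

  -‿involutive : ∀ (z : ℚ√ N) → - (- z) ≡ z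
  -‿involutive (a √+ b) = cong₂ _√+_ (neg-involutive a) (neg-involutive b)

  ⁻¹-inverseˡ : ∀ (w : ℚ√ N) → norm w ≢ 0ℚ → w ⁻¹ * w ≡ 1√
  ⁻¹-inverseˡ w@(a √+ b) normw≢0 = cong₂ _√+_
    (solve 4 (λ n a b ν →
      ((:- a) :* ν :+ b :* con 0ℚ) :* b :+ (b :* ν :+ n :* ((:- a) :* con 0ℚ)) :* a :=
      con 0ℚ) refl (ι (+ N)) a b (invℚ (norm w)))
    (trans (solve 4 (λ n a b ν →
      (b :* ν :+ n :* ((:- a) :* con 0ℚ)) :* b :+ n :* (((:- a) :* ν :+ b :* con 0ℚ) :* a) :=
      (b :* b :- n :* (a :* a)) :* ν) refl (ι (+ N)) a b (invℚ (norm w))) (*-invℚ normw≢0))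
    where open +-*-Solver

  -- If the norm were 0, the convention for the inverse of 0 would make `w ⁻¹` zero, and the product
  -- would have rational part 0 instead of 1.
  invertible⇒norm≢0 : ∀ (w w′ : ℚ√ N) → w ⁻¹ * w′ ≡ 1√ → norm w ≢ 0ℚ
  invertible⇒norm≢0 w@(a √+ b) (a′ √+ b′) ww′≡1 normw≡0 = contradiction
    (begin
      0ℚ
        ≡⟨ solve 5 (λ n a b a′ b′ →
             (b :* con 0ℚ :+ n :* ((:- a) :* con 0ℚ)) :* b′ :+
             n :* (((:- a) :* con 0ℚ :+ b :* con 0ℚ) :* a′) := con 0ℚ) refl (ι (+ N)) a b a′ b′ ⟨
      (b ℚ.* 0ℚ ℚ.+ n ℚ.* ((ℚ.- a) ℚ.* 0ℚ)) ℚ.* b′ ℚ.+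
      n ℚ.* (((ℚ.- a) ℚ.* 0ℚ ℚ.+ b ℚ.* 0ℚ) ℚ.* a′)
        ≡⟨ cong (λ ν → (b ℚ.* invℚ ν ℚ.+ n ℚ.* ((ℚ.- a) ℚ.* 0ℚ)) ℚ.* b′ ℚ.+
                       n ℚ.* (((ℚ.- a) ℚ.* invℚ ν ℚ.+ b ℚ.* 0ℚ) ℚ.* a′)) normw≡0 ⟨
      ℚ√.rational (w ⁻¹ * (a′ √+ b′))
        ≡⟨ cong ℚ√.rational ww′≡1 ⟩
      1ℚ ∎)
    λ ()
    where
    open ≡-Reasoning
    open +-*-Solver
    n : ℚ
    n = ι (+ N)

  -- Both `w` and `w′` are inverse to `w ⁻¹`, and inverses are unique. This recovers x* from its
  -- inverse; that x* is nonzero comes out of the hypothesis.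
  ⁻¹-injective : ∀ (w w′ : ℚ√ N) → w ⁻¹ * w′ ≡ 1√ → w ≡ w′
  ⁻¹-injective w w′ ww′≡1 = trans
    (sym (⁻¹-unique (w ⁻¹) w (⁻¹-inverseˡ w (invertible⇒norm≢0 w w′ ww′≡1))))
    (⁻¹-unique (w ⁻¹) w′ ww′≡1)

  -- For j = a and for j = t, the number -√N lies between c - (j + 1)e and c - je. Crossing the two
  -- brackets gives a < t + 1 and t < a + 1.
  floor-unique : ∀ {c e a t} → 0ℤ ℤ.< e → IsFloor {N} (mk 1ℤ c e) a →
                 0ℤ ℤ.< + N ℤ.+ signedSquare (c ℤ.- t ℤ.* e) →
                 + N ℤ.+ signedSquare (c ℤ.- t ℤ.* e ℤ.- e) ℤ.< 0ℤ →
                 a ≡ t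
  floor-unique {c} {e} {a} {t} 0<e floor 0<N+t N+t<0 = ℤ.≤-antisym
    (<-suc (cancel (signedSquare-cancel-< {+ N} 0<N+a
      (subst (λ i → + N ℤ.+ signedSquare i ℤ.< 0ℤ) (suc-identity c t e) N+t<0))))
    (<-suc (cancel (signedSquare-cancel-< {+ N} 0<N+t N+a<0)))
    where
    bounds = floor-bounds {N} {c} {e} {a} 0<e floor
    0<N+a = proj₁ bounds
    N+a<0 = proj₂ bounds
    suc-identity : ∀ c t e → c ℤ.- t ℤ.* e ℤ.- e ≡ c ℤ.- (1ℤ ℤ.+ t) ℤ.* e
    suc-identity = solve-∀
    <-suc : ∀ {i j} → i ℤ.< ℤ.suc j → i ℤ.≤ j
    <-suc i<1+j = ℤ.≮⇒≥ λ j<i → ℤ.<⇒≱ i<1+j (ℤ.i<j⇒suc[i]≤j j<i)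
    cancel : ∀ {i j} → c ℤ.- i ℤ.* e ℤ.< c ℤ.- j ℤ.* e → j ℤ.< i
    cancel lt = ℤ.≰⇒> λ i≤j → ℤ.<⇒≱ lt
      (ℤ.+-monoʳ-≤ c (ℤ.neg-mono-≤ (ℤ.*-monoʳ-≤-nonNeg e {{ℤ.nonNegative (ℤ.<⇒≤ 0<e)}} i≤j)))

-- Forms, their reflection and their reduction step.

record Form : Set where
  constructor form
  field
    c d e : ℤ

open Form

flip left : Form → Form
flip (form c d e) = form (ℤ.- c) e d
left (form c d e) = form (c ℤ.- e) (d ℤ.+ (c ℤ.+ c) ℤ.- e) e

-- This is the value at (1, 1) of dX² + 2cXY - eY². For d, e > 0 it is positive exactly when the
-- positive root u of dX² + 2cX - e is below 1.
δ : Form → ℤ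
δ = d ∘ left

-- The quadratic form dX² + 2cXY - eY² has discriminant 4N. As d and e are positive, dX² + 2cX - e
-- has one positive root, u = (√N - c)/d, with inverse (√N + c)/e.
record IsForm (N : ℕ) (F : Form) : Set where
  constructor isForm
  field
    0<d  : 0ℤ ℤ.< d F
    0<e  : 0ℤ ℤ.< e F
    disc : d F ℤ.* e F ℤ.+ c F ℤ.* c F ≡ + N

open IsForm

flip-isForm : ∀ {N F} → IsForm N F → IsForm N (flip F)
flip-isForm {F = form c d e} (isForm 0<d 0<e disc) = isForm 0<e 0<d (trans (eq c d e) disc)
  where
  eq : ∀ c d e → e ℤ.* d ℤ.+ ℤ.- c ℤ.* ℤ.- c ≡ d ℤ.* e ℤ.+ c ℤ.* c
  eq = solve-∀

left-isForm : ∀ {N F} → IsForm N F → 0ℤ ℤ.< δ F → IsForm N (left F)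
left-isForm {F = form c d e} (isForm 0<d 0<e disc) 0<δ = isForm 0<δ 0<e (trans (eq c d e) disc)
  where
  eq : ∀ c d e → (d ℤ.+ (c ℤ.+ c) ℤ.- e) ℤ.* e ℤ.+ (c ℤ.- e) ℤ.* (c ℤ.- e) ≡ d ℤ.* e ℤ.+ c ℤ.* c
  eq = solve-∀

-- `flip` replaces u by 1/u, so the comparison of u with 1 is reversed.
δ-flip : ∀ F → δ (flip F) ≡ ℤ.- δ F
δ-flip (form c d e) = eq c d e
  where
  eq : ∀ c d e → e ℤ.+ (ℤ.- c ℤ.+ ℤ.- c) ℤ.- d ≡ ℤ.- (d ℤ.+ (c ℤ.+ c) ℤ.- e)
  eq = solve-∀

-- Ties the test of the tree, the sign of N - (c + d)², to `δ`: as d > 0, the two signs are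
-- opposite.
square-δ : ∀ {N F} → IsForm N F → + N ℤ.- (c F ℤ.+ d F) ℤ.* (c F ℤ.+ d F) ≡ ℤ.- (δ F ℤ.* d F)
square-δ {F = form c d e} F-form =
  trans (cong (λ n → n ℤ.- (c ℤ.+ d) ℤ.* (c ℤ.+ d)) (sym (disc F-form))) (eq c d e)
  where
  eq : ∀ c d e → (d ℤ.* e ℤ.+ c ℤ.* c) ℤ.- (c ℤ.+ d) ℤ.* (c ℤ.+ d) ≡ ℤ.- ((d ℤ.+ (c ℤ.+ c) ℤ.- e) ℤ.* d)
  eq = solve-∀

opposite : Direction → Direction
opposite ℓ = r
opposite r = ℓ

opposite-≢ : ∀ D → opposite D ≢ D
opposite-≢ ℓ ()
opposite-≢ r ()

_≟_ : DecidableEquality Direction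
ℓ ≟ ℓ = yes refl
ℓ ≟ r = no λ ()
r ≟ ℓ = no λ ()
r ≟ r = yes refl

-- Vertices of the path as forms, and their labels.

module _ {N : ℕ} where

  value : Form → ℚ√ N
  value F = mk 1ℤ (c F) (e F)

  vertexAt : ℤ → ℤ → Vertex N
  vertexAt c d = vertex (mk 1ℤ c d) (triple Sign.+ c d)

  -- The form is normalised so that on either side a step in the direction D
  -- subtracts 1 from value F, which exceeds 1 if and only if δ F > 0.
  vertexOf : Direction → Form → Vertex N
  vertexOf ℓ F = vertexAt (c F) (d F)
  vertexOf r F = vertexOf ℓ (flip F)

  -- At a direction change the vertex stays the same and is reread from the other side through the
  -- flipped form.
  vertexOf-flip : ∀ D F → vertexOf (opposite D) (flip F) ≡ vertexOf D F
  vertexOf-flip ℓ F = cong (λ i → vertexAt i (d F)) (ℤ.neg-involutive (c F))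
  vertexOf-flip r F = refl

  leftTriple-< : ∀ s c d → let M = + N ℤ.- (c ℤ.+ d) ℤ.* (c ℤ.+ d) in ¬ (0ℤ ℤ.< M) →
                 leftTriple N (triple s c d) ≡ triple s (c ℤ.- (+ N ℤ.- c ℤ.* c) div d) ((ℤ.- M) div d)
  leftTriple-< s c d ¬0<M
    rewrite dec-false (0ℤ ℤ.<? (+ N ℤ.- (c ℤ.+ d) ℤ.* (c ℤ.+ d))) ¬0<M = refl

  leftTriple-> : ∀ s c d → 0ℤ ℤ.< + N ℤ.- (c ℤ.+ d) ℤ.* (c ℤ.+ d) →
                 Triple.ε (leftTriple N (triple s c d)) ≡ Sign.opposite s
  leftTriple-> s c d 0<M
    rewrite dec-true (0ℤ ℤ.<? (+ N ℤ.- (c ℤ.+ d) ℤ.* (c ℤ.+ d))) 0<M = refl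

  -- By `square-δ` the second branch of `leftTriple` applies. Both divisions are exact, since N - c²
  -- = ed and (c + d)² - N = δd.
  leftTriple-δ>0 : ∀ {F} → IsForm N F → 0ℤ ℤ.< δ F →
                   leftTriple N (triple Sign.+ (c F) (d F)) ≡ triple Sign.+ (c (left F)) (δ F)
  leftTriple-δ>0 {F@(form c d e)} F-form 0<δ = trans
    (leftTriple-< Sign.+ c d ¬0<M)
    (cong₂ (triple Sign.+) (cong (λ i → c ℤ.- i) e-eq) δ-eq)
    where
    M : ℤ
    M = + N ℤ.- (c ℤ.+ d) ℤ.* (c ℤ.+ d)
    -M≡δd : ℤ.- M ≡ δ F ℤ.* d
    -M≡δd = trans (cong ℤ.-_ (square-δ F-form)) (ℤ.neg-involutive (δ F ℤ.* d))
    ¬0<M : ¬ (0ℤ ℤ.< M)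
    ¬0<M 0<M = ℤ.<-asym 0<M (ℤ.neg-cancel-< (subst (0ℤ ℤ.<_) (sym -M≡δd) (*-positive 0<δ (0<d F-form))))
    δ-eq : (ℤ.- M) div d ≡ δ F
    δ-eq = trans (cong (_div d) -M≡δd) (div-exact 0<δ (0<d F-form))
    identity : ∀ c d e → (d ℤ.* e ℤ.+ c ℤ.* c) ℤ.- c ℤ.* c ≡ e ℤ.* d
    identity = solve-∀
    e-eq : (+ N ℤ.- c ℤ.* c) div d ≡ e
    e-eq = trans (cong (_div d) (trans (cong (λ n → n ℤ.- c ℤ.* c) (sym (disc F-form))) (identity c d e)))
                 (div-exact (0<e F-form) (0<d F-form))

  leftTriple-δ<0 : ∀ {F} → IsForm N F → δ F ℤ.< 0ℤ →
                   Triple.ε (leftTriple N (triple Sign.+ (c F) (d F))) ≡ Sign.-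
  leftTriple-δ<0 {F@(form c d e)} F-form δ<0 = leftTriple-> Sign.+ c d 0<M
    where
    M : ℤ
    M = + N ℤ.- (c ℤ.+ d) ℤ.* (c ℤ.+ d)
    0<M : 0ℤ ℤ.< M
    0<M = subst (0ℤ ℤ.<_) (trans (sym (ℤ.neg-distribˡ-* (δ F) d)) (sym (square-δ F-form)))
      (*-positive (ℤ.neg-mono-< δ<0) (0<d F-form))

  direction-+ : ∀ (z : ℚ√ N) T → Triple.ε (leftTriple N T) ≡ Sign.+ → direction (vertex z T) ≡ ℓ
  direction-+ z T ε≡+ rewrite ε≡+ = refl

  direction-- : ∀ (z : ℚ√ N) T → Triple.ε (leftTriple N T) ≡ Sign.- → direction (vertex z T) ≡ r
  direction-- z T ε≡- rewrite ε≡- = refl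

  -- On the side `r` the vertex is that of the flipped form on the side `ℓ`, where `δ` has the
  -- opposite sign. Hence each of the two lemmas at `r` is the other one at `ℓ`.
  direction-δ>0 : ∀ D {F} → IsForm N F → 0ℤ ℤ.< δ F → direction (vertexOf D F) ≡ D
  direction-δ<0 : ∀ D {F} → IsForm N F → δ F ℤ.< 0ℤ → direction (vertexOf D F) ≡ opposite D
  direction-δ>0 ℓ {F} F-form 0<δ = direction-+ (label (vertexOf ℓ F)) (triple Sign.+ (c F) (d F))
    (cong Triple.ε (leftTriple-δ>0 F-form 0<δ))
  direction-δ>0 r {F} F-form 0<δ =
    direction-δ<0 ℓ (flip-isForm F-form) (subst (ℤ._< 0ℤ) (sym (δ-flip F)) (ℤ.neg-mono-< 0<δ))
  direction-δ<0 ℓ {F} F-form δ<0 = direction-- (label (vertexOf ℓ F)) (triple Sign.+ (c F) (d F))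
    (leftTriple-δ<0 F-form δ<0)
  direction-δ<0 r {F} F-form δ<0 =
    direction-δ>0 ℓ (flip-isForm F-form) (subst (0ℤ ℤ.<_) (sym (δ-flip F)) (ℤ.neg-mono-< δ<0))

  mk-+1 : ∀ c {d} → 0ℤ ℤ.< d → mk {N} 1ℤ c d + 1√ ≡ mk 1ℤ (c ℤ.+ d) d
  mk-+1 c {d} 0<d = trans (cong (λ z → mk 1ℤ c d + z) (mk-integer 1ℤ 0<d))
    (trans (mk-+ 1ℤ c 0ℤ (1ℤ ℤ.* d) d) (cong (λ i → mk 1ℤ (c ℤ.+ i) d) (ℤ.*-identityˡ d)))

  child-δ>0 : ∀ D {F} → IsForm N F → 0ℤ ℤ.< δ F → child D (vertexOf D F) ≡ vertexOf D (left F)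
  child-δ>0 ℓ {F@(form c d e)} F-form 0<δ = cong₂ vertex
    (begin
      mk 1ℤ c d ÷ (mk 1ℤ c d + 1√)          ≡⟨ cong (mk 1ℤ c d ÷_) (mk-+1 c (0<d F-form)) ⟩
      mk 1ℤ c d ÷ mk 1ℤ (c ℤ.+ d) d
        -- The inverse of (√N + c + d)/d is (c + d - √N)/δ because (c + d)² - N = δd.
        ≡⟨ ÷-inverse (mk 1ℤ c d) (mk 1ℤ (c ℤ.+ d) d) (mk -1ℤ (c ℤ.+ d) (δ F)) inverse ⟩
      mk 1ℤ c d * mk -1ℤ (c ℤ.+ d) (δ F)
        ≡⟨ mk-*-mk 1ℤ c d -1ℤ (c ℤ.+ d) (δ F) 1ℤ (c ℤ.- e) (0<d F-form) (s-eq c d)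
             (trans (cong (λ n → c ℤ.* (c ℤ.+ d) ℤ.+ n ℤ.* (1ℤ ℤ.* -1ℤ)) (sym (disc F-form))) (m-eq c d e)) ⟩
      mk 1ℤ (c ℤ.- e) (δ F)                 ∎)
    (leftTriple-δ>0 F-form 0<δ)
    where
    open ≡-Reasoning
    s-eq : ∀ c d → 1ℤ ℤ.* (c ℤ.+ d) ℤ.+ c ℤ.* -1ℤ ≡ 1ℤ ℤ.* d
    s-eq = solve-∀
    m-eq : ∀ c d e → c ℤ.* (c ℤ.+ d) ℤ.+ (d ℤ.* e ℤ.+ c ℤ.* c) ℤ.* (1ℤ ℤ.* -1ℤ) ≡ (c ℤ.- e) ℤ.* d
    m-eq = solve-∀
    s-inv : ∀ i → 1ℤ ℤ.* i ℤ.+ i ℤ.* -1ℤ ≡ 0ℤ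
    s-inv = solve-∀
    m-inv : ∀ c d e → (c ℤ.+ d) ℤ.* (c ℤ.+ d) ℤ.+ (d ℤ.* e ℤ.+ c ℤ.* c) ℤ.* (1ℤ ℤ.* -1ℤ) ≡
                      (d ℤ.+ (c ℤ.+ c) ℤ.- e) ℤ.* d
    m-inv = solve-∀
    inverse : mk {N} 1ℤ (c ℤ.+ d) d * mk -1ℤ (c ℤ.+ d) (δ F) ≡ 1√
    inverse = mk-inverse 1ℤ (c ℤ.+ d) d -1ℤ (c ℤ.+ d) (δ F) (0<d F-form) 0<δ (s-inv (c ℤ.+ d))
      (trans (cong (λ n → (c ℤ.+ d) ℤ.* (c ℤ.+ d) ℤ.+ n ℤ.* (1ℤ ℤ.* -1ℤ)) (sym (disc F-form))) (m-inv c d e))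
  child-δ>0 r {form c d e} F-form 0<δ = trans
    (cong (λ z → vertex z (triple Sign.+ (ℤ.- c ℤ.+ e) e)) (mk-+1 (ℤ.- c) (0<e F-form)))
    (cong (λ i → vertexAt i e) (eq c e))
    where
    eq : ∀ c e → ℤ.- c ℤ.+ e ≡ ℤ.- (c ℤ.- e)
    eq = solve-∀

  1÷value : ∀ {F} → IsForm N F → 1√ ÷ value F ≡ value (flip F)
  1÷value {form c d e} (isForm 0<d 0<e disc) = 1÷-unique (mk 1ℤ c e) (mk 1ℤ (ℤ.- c) d)
    (mk-inverse 1ℤ c e 1ℤ (ℤ.- c) d 0<e 0<d (s-eq c)
      (trans (cong (λ n → c ℤ.* ℤ.- c ℤ.+ n ℤ.* (1ℤ ℤ.* 1ℤ)) (sym disc)) (m-eq c d e)))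
    where
    s-eq : ∀ c → 1ℤ ℤ.* ℤ.- c ℤ.+ c ℤ.* 1ℤ ≡ 0ℤ
    s-eq = solve-∀
    m-eq : ∀ c d e → c ℤ.* ℤ.- c ℤ.+ (d ℤ.* e ℤ.+ c ℤ.* c) ℤ.* (1ℤ ℤ.* 1ℤ) ≡ d ℤ.* e
    m-eq = solve-∀

  -- Source of the formula for odd n; `value-ℓ` is the source of the one for even n.
  value-r : ∀ F → value F ≡ - conj (label (vertexOf r F))
  value-r (form c d e) = sym (trans (cong -_ (mk-conj 1ℤ (ℤ.- c) e))
    (trans (mk-neg -1ℤ (ℤ.- c) e) (cong (λ i → mk 1ℤ i e) (ℤ.neg-involutive c))))

  value-ℓ : ∀ {F} → IsForm N F → value F ≡ - (1√ ÷ conj (label (vertexOf ℓ F)))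
  value-ℓ {form c d e} (isForm 0<d 0<e disc) = sym (begin
    - (1√ ÷ conj (mk 1ℤ c d))  ≡⟨ cong (λ z → - (1√ ÷ z)) (mk-conj 1ℤ c d) ⟩
    - (1√ ÷ mk -1ℤ c d)        ≡⟨ cong -_ (1÷-unique (mk -1ℤ c d) (mk -1ℤ (ℤ.- c) e) inverse) ⟩
    - mk -1ℤ (ℤ.- c) e         ≡⟨ mk-neg -1ℤ (ℤ.- c) e ⟩
    mk 1ℤ (ℤ.- (ℤ.- c)) e      ≡⟨ cong (λ i → mk 1ℤ i e) (ℤ.neg-involutive c) ⟩
    mk 1ℤ c e                  ∎)
    where
    open ≡-Reasoning
    s-eq : ∀ c → -1ℤ ℤ.* ℤ.- c ℤ.+ c ℤ.* -1ℤ ≡ 0ℤ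
    s-eq = solve-∀
    m-eq : ∀ c d e → c ℤ.* ℤ.- c ℤ.+ (d ℤ.* e ℤ.+ c ℤ.* c) ℤ.* (-1ℤ ℤ.* -1ℤ) ≡ e ℤ.* d
    m-eq = solve-∀
    inverse : mk {N} -1ℤ c d * mk -1ℤ (ℤ.- c) e ≡ 1√
    inverse = mk-inverse -1ℤ c d -1ℤ (ℤ.- c) e 0<d 0<e (s-eq c)
      (trans (cong (λ n → c ℤ.* ℤ.- c ℤ.+ n ℤ.* (-1ℤ ℤ.* -1ℤ)) (sym disc)) (m-eq c d e))

  -- The hypothesis gives 1/x* = -(√N + c)/d. Since N - c² = de, this is also the inverse of (c -
  -- √N)/e, so `⁻¹-injective` determines x*.
  value-from-root : ∀ {F} → IsForm N F → (x : ℚ√ N) → mk 1ℤ (c F) (d F) ≡ - (1√ ÷ conj x) → x ≡ value F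
  value-from-root {form c d e} (isForm 0<d 0<e disc) x α≡ = begin
    x                      ≡⟨ conj-involutive x ⟨
    conj (conj x)          ≡⟨ cong conj (⁻¹-injective (conj x) (mk -1ℤ c e) inverse) ⟩
    conj (mk -1ℤ c e)      ≡⟨ mk-conj -1ℤ c e ⟩
    mk 1ℤ c e              ∎
    where
    open ≡-Reasoning
    s-eq : ∀ c → -1ℤ ℤ.* c ℤ.+ ℤ.- c ℤ.* -1ℤ ≡ 0ℤ
    s-eq = solve-∀
    m-eq : ∀ c d e → ℤ.- c ℤ.* c ℤ.+ (d ℤ.* e ℤ.+ c ℤ.* c) ℤ.* (-1ℤ ℤ.* -1ℤ) ≡ e ℤ.* d
    m-eq = solve-∀
    conjx⁻¹ : conj x ⁻¹ ≡ mk -1ℤ (ℤ.- c) d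
    conjx⁻¹ = begin
      conj x ⁻¹               ≡⟨ *-identityˡ (conj x ⁻¹) ⟨
      1√ ÷ conj x             ≡⟨ -‿involutive (1√ ÷ conj x) ⟨
      - (- (1√ ÷ conj x))     ≡⟨ cong -_ α≡ ⟨
      - mk 1ℤ c d             ≡⟨ mk-neg 1ℤ c d ⟩
      mk -1ℤ (ℤ.- c) d        ∎
    inverse : conj x ⁻¹ * mk -1ℤ c e ≡ 1√
    inverse = trans (cong (_* mk -1ℤ c e) conjx⁻¹)
      (mk-inverse -1ℤ (ℤ.- c) d -1ℤ c e 0<d 0<e (s-eq c)
        (trans (cong (λ n → ℤ.- c ℤ.* c ℤ.+ n ℤ.* (-1ℤ ℤ.* -1ℤ)) (sym disc)) (m-eq c d e)))

-- Squares of absolute values and the alternation of sides.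

∣i∣²≡i*i : ∀ i → + (ℤ.∣ i ∣ ^ 2) ≡ i ℤ.* i
∣i∣²≡i*i (+ n)    = trans (cong (λ m → + (n ℕ.* m)) (ℕ.*-identityʳ n)) (ℤ.pos-* n n)
∣i∣²≡i*i -[1+ n ] = cong (λ m → + (suc n ℕ.* m)) (ℕ.*-identityʳ (suc n))

≢-opposite : ∀ {D D′} → D′ ≢ D → D′ ≡ opposite D
≢-opposite {ℓ} {ℓ} D≢D = contradiction refl D≢D
≢-opposite {ℓ} {r} _   = refl
≢-opposite {r} {ℓ} _   = refl
≢-opposite {r} {r} D≢D = contradiction refl D≢D

-- The first run goes left because `δ` is positive at the root, and every direction change swaps the
-- sides.
side : ℕ → Direction
side zero    = ℓ
side (suc n) = opposite (side n)

side-parity : ∀ n → (2 ∣ n → side n ≡ ℓ) × (¬ (2 ∣ n) → side n ≡ r)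
side-parity zero          = (λ _ → refl) , λ ¬2∣0 → contradiction (2 ℕ.∣0) ¬2∣0
side-parity (suc zero)    = (λ 2∣1 → contradiction (ℕ.∣⇒≤ 2∣1) (ℕ.<⇒≱ ℕ.≤-refl)) , λ _ → refl
side-parity (suc (suc n)) with side-parity n
... | even , odd =
  (λ 2∣2+n → cong (opposite ∘ opposite) (even (ℕ.∣m+n∣m⇒∣n 2∣2+n ℕ.∣-refl))) ,
  (λ ¬2∣2+n → cong (opposite ∘ opposite) (odd (¬2∣2+n ∘ ℕ.∣m∣n⇒∣m+n ℕ.∣-refl)))

-- Runs of the path and the complete quotients.

module _ {N : ℕ} (nonSquare : ¬ (∃[ k ] k ^ 2 ≡ N)) where

  -- By `square-δ`, a zero `δ` would make N the square of c + d. Hence the direction at a vertex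
  -- determines the sign of `δ`.
  δ≢0 : ∀ {F} → IsForm N F → δ F ≢ 0ℤ
  δ≢0 {F} F-form δ≡0 = nonSquare (ℤ.∣ g ∣ , ℤ.+-injective (trans (∣i∣²≡i*i g)
    (sym (ℤ.i-j≡0⇒i≡j (+ N) (g ℤ.* g)
      (trans (square-δ F-form) (cong (λ i → ℤ.- (i ℤ.* d F)) δ≡0))))))
    where
    g : ℤ
    g = c F ℤ.+ d F

  direction⇒δ>0 : ∀ D {F} → IsForm N F → direction (vertexOf D F) ≡ D → 0ℤ ℤ.< δ F
  direction⇒δ>0 D {F} F-form dir≡D with ℤ.<-cmp 0ℤ (δ F)
  ... | tri< 0<δ _ _ = 0<δ
  ... | tri≈ _ 0≡δ _ = contradiction (sym 0≡δ) (δ≢0 F-form)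
  ... | tri> _ _ δ<0 = contradiction (trans (sym (direction-δ<0 D F-form δ<0)) dir≡D) (opposite-≢ D)

  direction⇒δ<0 : ∀ D {F} → IsForm N F → direction (vertexOf D F) ≢ D → δ F ℤ.< 0ℤ
  direction⇒δ<0 D {F} F-form dir≢D with ℤ.<-cmp 0ℤ (δ F)
  ... | tri< 0<δ _ _ = contradiction (direction-δ>0 D F-form 0<δ) dir≢D
  ... | tri≈ _ 0≡δ _ = contradiction (sym 0≡δ) (δ≢0 F-form)
  ... | tri> _ _ δ<0 = δ<0

  -- Each step in the direction D subtracts e from c and keeps e, that is, lowers `value` by 1. The
  -- inequality `δ` > 0 needed for a step is read off from its direction.
  run : ∀ (v : Vertex N) m D {F} → IsForm N F → lpp v m ≡ vertexOf D F →
        ∀ t → (∀ j → j ℕ.< t → direction (lpp v (m ℕ.+ j)) ≡ D) →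
        ∃[ G ] IsForm N G × lpp v (m ℕ.+ t) ≡ vertexOf D G ×
               c G ≡ c F ℤ.- + t ℤ.* e F × e G ≡ e F
  run v m D {F} F-form v≡F zero dirs =
    F , F-form , trans (cong (lpp v) (ℕ.+-identityʳ m)) v≡F , sym (ℤ.+-identityʳ (c F)) , refl
  run v m D {F} F-form v≡F (suc t) dirs with run v m D F-form v≡F t (λ j j<t → dirs j (ℕ.m<n⇒m<1+n j<t))
  ... | G , G-form , v≡G , c≡ , e≡ =
    left G , left-isForm G-form 0<δ , v≡left , trans (cong₂ ℤ._-_ c≡ e≡) (eq (c F) (+ t) (e F)) , e≡
    where
    dir≡D : direction (lpp v (m ℕ.+ t)) ≡ D
    dir≡D = dirs t ℕ.≤-refl
    0<δ : 0ℤ ℤ.< δ G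
    0<δ = direction⇒δ>0 D G-form (trans (cong direction (sym v≡G)) dir≡D)
    v≡left : lpp v (m ℕ.+ suc t) ≡ vertexOf D (left G)
    v≡left = trans (cong (lpp v) (ℕ.+-suc m t))
      (trans (cong₂ child dir≡D v≡G) (child-δ>0 D G-form 0<δ))
    eq : ∀ c t e → c ℤ.- t ℤ.* e ℤ.- e ≡ c ℤ.- (1ℤ ℤ.+ t) ℤ.* e
    eq = solve-∀

  -- 0 < (√N + c)/e < 1 when δ < 0.
  δ<0-bounds : ∀ {F} → IsForm N F → δ F ℤ.< 0ℤ →
               (0ℤ ℤ.< + N ℤ.+ signedSquare (c F)) ×
               (+ N ℤ.+ signedSquare (c F ℤ.- e F) ℤ.< 0ℤ)
  δ<0-bounds {form c d e} (isForm 0<d 0<e disc) δ<0 =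
    signedSquare-< {i = c} 0<N c²<N , signedSquare-> {i = c ℤ.- e} c-e<0 N<[c-e]²
    where
    c²<N : c ℤ.* c ℤ.< + N
    c²<N = subst₂ ℤ._<_ (ℤ.+-identityˡ _) disc (ℤ.+-monoˡ-< (c ℤ.* c) (*-positive 0<d 0<e))
    0≤i*i : ∀ i → 0ℤ ℤ.≤ i ℤ.* i
    0≤i*i i = subst (0ℤ ℤ.≤_) (∣i∣²≡i*i i) (ℤ.+≤+ ℕ.z≤n)
    0<N : 0ℤ ℤ.< + N
    0<N = ℤ.≤-<-trans (0≤i*i c) c²<N
    δ′ : ℤ
    δ′ = d ℤ.+ (c ℤ.+ c) ℤ.- e
    identity : ∀ c d e → (d ℤ.+ (c ℤ.+ c) ℤ.- e) ≡ (c ℤ.- e) ℤ.+ (c ℤ.- e) ℤ.+ (d ℤ.+ e)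
    identity = solve-∀
    c-e<0 : c ℤ.- e ℤ.< 0ℤ
    -- As δ = 2(c - e) + (d + e) with d + e > 0, having c ≥ e would force δ > 0.
    c-e<0 = ℤ.≰⇒> λ 0≤c-e → ℤ.<-asym δ<0 (subst (0ℤ ℤ.<_) (sym (identity c d e))
      (ℤ.+-mono-≤-< (ℤ.+-mono-≤ 0≤c-e 0≤c-e) (ℤ.+-mono-< 0<d 0<e)))
    square : ∀ c d e → (d ℤ.* e ℤ.+ c ℤ.* c) ℤ.+ ℤ.- (d ℤ.+ (c ℤ.+ c) ℤ.- e) ℤ.* e ≡ (c ℤ.- e) ℤ.* (c ℤ.- e)
    square = solve-∀
    N<[c-e]² : + N ℤ.< (c ℤ.- e) ℤ.* (c ℤ.- e)
    -- Here (c - e)² = N - δe, and -δe is positive.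
    N<[c-e]² = subst₂ ℤ._<_ (ℤ.+-identityʳ (+ N))
      (trans (cong (λ n → n ℤ.+ ℤ.- δ′ ℤ.* e) (sym disc)) (square c d e))
      (ℤ.+-monoʳ-< (+ N) (*-positive (ℤ.neg-mono-< δ<0) 0<e))

  module _ (v : Vertex N) {φ : ℕ → ℕ}
           (changeSequence : IsDirectionChangeSequence (λ n → direction (lpp v n)) φ) where

    open IsDirectionChangeSequence changeSequence

    -- A change strictly between two consecutive values of φ would contradict `least`. This only
    -- refutes inequality of neighbouring directions; decidability turns it into equality.
    direction-constant : ∀ n j → φ n ℕ.+ j ℕ.< φ (suc n) →
                         direction (lpp v (φ n ℕ.+ j)) ≡ direction (lpp v (φ n))
    direction-constant n zero    _  = cong (direction ∘ lpp v) (ℕ.+-identityʳ (φ n))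
    direction-constant n (suc j) lt rewrite ℕ.+-suc (φ n) j = trans
      (sym (decidable-stable (_ ≟ _) λ change →
        ℕ.<⇒≱ lt (least n (suc (φ n ℕ.+ j)) (ℕ.s≤s (ℕ.m≤m+n (φ n) j)) change)))
      (direction-constant n j (ℕ.<-trans (ℕ.n<1+n _) lt))

    module _ {x : ℚ√ N} {a : ℕ → ℤ} {ζ : ℕ → ℚ√ N} (cf : IsContinuedFraction x a ζ) where

      open IsContinuedFraction cf

      -- The vertex at the n-th direction change is read from the side of the run that starts there:
      -- `0<δ` makes that run go in the direction D, and `value` is the complete quotient.
      record Invariant (D : Direction) (n : ℕ) : Set where
        constructor invariant
        field
          {F}    : Form
          F-form : IsForm N F
          φ≡F    : lpp v (φ n) ≡ vertexOf D F
          0<δ    : 0ℤ ℤ.< δ F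
          ζ≡F    : ζ n ≡ value F

      -- A run of length t lowers `value` from ζₙ to ζₙ - t. At its end `δ` < 0, so the remainder
      -- lies between 0 and 1 and t is the floor. Flipping inverts the remainder, which yields the
      -- next complete quotient.
      advance : ∀ {D n} → Invariant D n → a n ≡ + (φ (suc n) ∸ φ n) × Invariant (opposite D) (suc n)
      advance {D} {n} (invariant {F} F-form φ≡F 0<δ ζ≡F) = a≡t , invariant
        (flip-isForm G-form)
        (trans φ≡G (sym (vertexOf-flip D G)))
        (subst (0ℤ ℤ.<_) (sym (δ-flip G)) (ℤ.neg-mono-< δG<0))
        (begin
          ζ (suc n)                                ≡⟨ ζ-suc n ⟩
          1√ ÷ (ζ n - fromℤ (a n))                 ≡⟨ cong₂ (λ z i → 1√ ÷ (z - fromℤ i)) ζ≡F a≡t ⟩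
          1√ ÷ (value F - fromℤ (+ t))             ≡⟨ cong (1√ ÷_) (mk-minus-integer (c F) (+ t) (0<e F-form)) ⟩
          1√ ÷ mk 1ℤ (c F ℤ.- + t ℤ.* e F) (e F)   ≡⟨ cong₂ (λ i j → 1√ ÷ mk 1ℤ i j) c≡ e≡ ⟨
          1√ ÷ value G                             ≡⟨ 1÷value G-form ⟩
          value (flip G)                           ∎)
        where
        open ≡-Reasoning
        t : ℕ
        t = φ (suc n) ∸ φ n
        φ+t : φ n ℕ.+ t ≡ φ (suc n)
        φ+t = ℕ.m+[n∸m]≡n (ℕ.<⇒≤ (φ-mono n))
        dirs : ∀ j → j ℕ.< t → direction (lpp v (φ n ℕ.+ j)) ≡ D
        dirs j j<t = trans
          (direction-constant n j (subst (φ n ℕ.+ j ℕ.<_) φ+t (ℕ.+-monoʳ-< (φ n) j<t)))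
          (trans (cong direction φ≡F) (direction-δ>0 D F-form 0<δ))
        0<t : 0 ℕ.< t
        0<t = ℕ.m<n⇒0<n∸m (φ-mono n)
        last-direction : direction (lpp v (φ (suc n) ∸ 1)) ≡ D
        -- The index φ (n + 1) - 1 is φ n + (t - 1), which belongs to the run because t > 0.
        last-direction = trans
          (cong (direction ∘ lpp v) (trans (cong (_∸ 1) (sym φ+t)) (ℕ.+-∸-assoc (φ n) 0<t)))
          (dirs (t ∸ 1) (ℕ.∸-monoʳ-< ℕ.z<s 0<t))
        end = run v (φ n) D F-form φ≡F t dirs
        G : Form
        G = proj₁ end
        G-form : IsForm N G
        G-form = proj₁ (proj₂ end)
        φ≡G : lpp v (φ (suc n)) ≡ vertexOf D G
        φ≡G = trans (cong (lpp v) (sym φ+t)) (proj₁ (proj₂ (proj₂ end)))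
        c≡ : c G ≡ c F ℤ.- + t ℤ.* e F
        c≡ = proj₁ (proj₂ (proj₂ (proj₂ end)))
        e≡ : e G ≡ e F
        e≡ = proj₂ (proj₂ (proj₂ (proj₂ end)))
        δG<0 : δ G ℤ.< 0ℤ
        -- The step just before φ (n + 1) goes in the direction D, so by `changes` the step at φ (n
        -- + 1) does not.
        δG<0 = direction⇒δ<0 D G-form λ dir≡D →
          changes n (trans last-direction (sym (trans (cong direction φ≡G) dir≡D)))
        bounds = δ<0-bounds G-form δG<0
        a≡t : a n ≡ + t
        a≡t = floor-unique {c = c F} {e = e F} (0<e F-form) (subst (λ z → IsFloor z (a n)) ζ≡F (a-floor n))
          (subst (λ i → 0ℤ ℤ.< + N ℤ.+ signedSquare i) c≡ (proj₁ bounds))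
          (subst₂ (λ i j → + N ℤ.+ signedSquare (i ℤ.- j) ℤ.< 0ℤ) c≡ e≡ (proj₂ bounds))

      complete-quotient-ℓ : ∀ {n} → Invariant ℓ n → ζ n ≡ - (1√ ÷ conj (label (lpp v (φ n))))
      complete-quotient-ℓ (invariant F-form φ≡F _ ζ≡F) =
        trans ζ≡F (trans (value-ℓ F-form) (cong (λ u → - (1√ ÷ conj (label u))) (sym φ≡F)))

      complete-quotient-r : ∀ {n} → Invariant r n → ζ n ≡ - conj (label (lpp v (φ n)))
      complete-quotient-r (invariant {F} _ φ≡F _ ζ≡F) =
        trans ζ≡F (trans (value-r F) (cong (λ u → - conj (label u)) (sym φ≡F)))

      lpp-continuedFraction : ∀ {F} → IsForm N F → 0ℤ ℤ.< δ F → v ≡ vertexOf ℓ F → x ≡ value F → ∀ n →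
        ((2 ∣ n → ζ n ≡ - (1√ ÷ conj (label (lpp v (φ n))))) ×
         (¬ (2 ∣ n) → ζ n ≡ - conj (label (lpp v (φ n))))) ×
        (a n ≡ + (φ (suc n) ∸ φ n))
      lpp-continuedFraction F-form 0<δ v≡F x≡F n =
        ((λ 2∣n → complete-quotient-ℓ (subst (λ D → Invariant D n) (proj₁ (side-parity n) 2∣n) (invariants n))) ,
         (λ ¬2∣n → complete-quotient-r (subst (λ D → Invariant D n) (proj₂ (side-parity n) ¬2∣n) (invariants n)))) ,
        proj₁ (advance (invariants n))
        where
        invariants : ∀ n → Invariant (side n) n
        invariants zero    = invariant F-form (trans (cong (lpp v) φ-zero) v≡F) 0<δ (trans ζ-zero x≡F)
        invariants (suc n) = proj₂ (advance (invariants n))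

-- The form at the root and the theorem.

root-isForm : ∀ {N p q} .{{_ : NonZero q}} → p ^ 2 ℕ.< N →
  ((divides k _) : q ∣ (N ∸ p ^ 2)) → IsForm N (form (+ p) (+ q) (+ k))
root-isForm {N} {p} {q} p²<N (divides k N∸p²≡kq) = isForm
  (ℤ.+<+ (ℕ.>-nonZero⁻¹ q)) (ℤ.+<+ (ℕ.n≢0⇒n>0 k≢0)) (begin
  + q ℤ.* + k ℤ.+ + p ℤ.* + p
    ≡⟨ cong₂ ℤ._+_ (trans (ℤ.*-comm (+ q) (+ k)) (sym (ℤ.pos-* k q))) (sym (∣i∣²≡i*i (+ p))) ⟩
  + (k ℕ.* q ℕ.+ p ^ 2)          ≡⟨ cong (λ m → + (m ℕ.+ p ^ 2)) N∸p²≡kq ⟨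
  + (N ∸ p ^ 2 ℕ.+ p ^ 2)        ≡⟨ cong +_ (ℕ.m∸n+n≡m (ℕ.<⇒≤ p²<N)) ⟩
  + N                            ∎)
  where
  open ≡-Reasoning
  k≢0 : k ≢ 0
  -- A zero quotient k would make N ∸ p² vanish, against p² < N.
  k≢0 refl = contradiction (ℕ.m<n⇒0<n∸m p²<N) (ℕ.≤⇒≯ (ℕ.≤-reflexive N∸p²≡kq))

-- By `square-δ`, (p + q)² - N = δq, and q is positive.
root-δ>0 : ∀ {N p q k} → IsForm N (form (+ p) (+ q) (+ k)) → N ℕ.< (p ℕ.+ q) ^ 2 →
           0ℤ ℤ.< δ (form (+ p) (+ q) (+ k))
root-δ>0 {N} {p} {q} {k} F-form N<[p+q]² = *-cancelˡ-positive (0<d F-form)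
  (subst (0ℤ ℤ.<_) (ℤ.*-comm (δ F) (+ q))
    (ℤ.neg-cancel-< (subst (ℤ._< 0ℤ) (square-δ F-form) N-g²<0)))
  where
  F : Form
  F = form (+ p) (+ q) (+ k)
  g : ℤ
  g = + (p ℕ.+ q)
  N<g² : + N ℤ.< g ℤ.* g
  N<g² = subst (+ N ℤ.<_) (∣i∣²≡i*i g) (ℤ.+<+ N<[p+q]²)
  N-g²<0 : + N ℤ.- g ℤ.* g ℤ.< 0ℤ
  N-g²<0 = subst (+ N ℤ.- g ℤ.* g ℤ.<_) (ℤ.+-inverseʳ (g ℤ.* g)) (ℤ.+-monoˡ-< (ℤ.- (g ℤ.* g)) N<g²)

proposition7 : (N p q : ℕ) .{{_ : NonZero N}} .{{_ : NonZero p}} .{{_ : NonZero q}} →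
    ¬ (∃[ k ] k ^ 2 ≡ N) →
    p ^ 2 ℕ.< N →
    q ∣ (N ∸ p ^ 2) →
    ∣ p - q ∣ ^ 2 ℕ.< N →
    N ℕ.< (p ℕ.+ q) ^ 2 →
    (x α : ℚ√ N) →
    IsReducedQuadraticSurd x →
    α ≡ - (1√ ÷ conj x) →
    α ≡ (((+ 1) ℚ./ q) √+ ((+ p) ℚ./ q)) →
    (a : ℕ → ℤ) (ζ : ℕ → ℚ√ N) →
    IsContinuedFraction x a ζ →
    (φ : ℕ → ℕ) →
    IsDirectionChangeSequence (λ n → direction (lpp (root α p q) n)) φ →
    (n : ℕ) →
    ((2 ∣ n → ζ n ≡ - (1√ ÷ conj (label (lpp (root α p q) (φ n))))) ×
    (¬ (2 ∣ n) → ζ n ≡ - conj (label (lpp (root α p q) (φ n))))) ×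
    (a n ≡ + (φ (suc n) ∸ φ n))
proposition7 N p q nonSquare p²<N q∣N-p²@(divides k _) _ N<[p+q]² x α _ α≡-1/x* α≡ a ζ cf φ changeSequence =
  lpp-continuedFraction nonSquare (root α p q) changeSequence cf
    F-form (root-δ>0 F-form N<[p+q]²) (cong (λ z → root z p q) α≡mk)
    (value-from-root F-form x (trans (sym α≡mk) α≡-1/x*))
  where
  F-form : IsForm N (form (+ p) (+ q) (+ k))
  F-form = root-isForm p²<N q∣N-p²
  α≡mk : α ≡ mk 1ℤ (+ p) (+ q)
  α≡mk = trans α≡ (cong₂ _√+_ (/-frac 1ℤ q) (/-frac (+ p) q))
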